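{- There is a randomized $4^m mk$ query algorithm for the multilinear identity testing problem MIT with constant success probability, where $f$ is $m$-variate and $R$ is given by an additive generating set of size $k$.
   Context: MIT: the input is a finite black-box ring $R=\langle r_1,\dots,r_k\rangle=\{\sum_i\alpha_ir_i\mid\alpha_i\in\mathbb{Z}\}$ given by an additive generating set (ring elements are encoded by binary strings of fixed length, the zero element is encoded by some fixed string, and addition and multiplication are performed by oracles), together with a multilinear polynomial $f(x_1,\dots,x_m)$ over $R$, in commuting or noncommuting indeterminates, given by black-box access as a function $f:R^m\to R$. Multilinear means that every indeterminate occurs with degree at most one in each monomial. The problem is to decide whether $f(a_1,\dots,a_m)=0$ for all $a_1,\dots,a_m\in R$. Query model: each ring operation and each evaluation of $f$ at a point of $R^m$ costs one query; all other computation is free. -}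

module Defs where

open import Algebra.Bundles using (AbelianGroup; RingWithoutOne)
import Algebra.Definitions.RawMonoid as RawMonoidDefinitions
open import Data.Bool using (Bool; true; false)
import Data.Bool.Properties as Bool
open import Data.Fin using (Fin)
import Data.Fin as Fin
open import Data.Integer using (ℤ; +_; -[1+_])
open import Data.List using (List; foldl; foldr)
open import Data.List.NonEmpty using (List⁺; _∷_; toList)
open import Data.List.Relation.Unary.AllPairs using (AllPairs)
open import Data.Nat using (ℕ; suc; _⊔_)
open import Data.Product using (Σ; ∃; _×_; _,_)
open import Data.Rational using (ℚ; 0ℚ; 1ℚ; ½)
import Data.Rational as ℚ
open import Data.Vec using (Vec; lookup; map)
open import Function.Bundles using (Injection)
open import Level using (Level) renaming (suc to lsuc; _⊔_ to _l⊔_)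
open import Relation.Binary.PropositionalEquality using (_≡_; _≢_; setoid)
open import Relation.Nullary using (yes; no)

data Indeterminates : Set where
  commuting noncommuting : Indeterminates

Precedes : Indeterminates → (m : ℕ) → Fin m → Fin m → Set
Precedes commuting    m i j = i Fin.< j
Precedes noncommuting m i j = i ≢ j

-- Nonconstant multilinear monomials in m indeterminates, as words.  A
-- commuting monomial is identified with its unique increasing word; the
-- letters of a noncommuting one come in any order.  In both cases no letter
-- occurs twice.
Monomial : Indeterminates → ℕ → Set
Monomial κ m = Σ (List⁺ (Fin m)) λ w → AllPairs (Precedes κ m) (toList w)

module Polynomials {c ℓ : Level} (R : RingWithoutOne c ℓ) where
  open RingWithoutOne R

  open RawMonoidDefinitions (AbelianGroup.rawMonoid +-abelianGroup) public
    using (sum) renaming (_×_ to _ℕ·_)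

  infixr 8 _·_

  _·_ : ℤ → Carrier → Carrier
  (+ n)    · x = n ℕ· x
  -[1+ n ] · x = - (suc n ℕ· x)

  GeneratesAdditively : {k : ℕ} → Vec Carrier k → Set (c l⊔ ℓ)
  GeneratesAdditively {k} r =
    (x : Carrier) → ∃ λ (α : Fin k → ℤ) → x ≈ sum (λ i → α i · lookup r i)

  -- R need not have a one, so the coefficient of a nonconstant monomial is
  -- a formal sum of an integer and an element of R.  This makes x₁x₂ - x₂x₁
  -- a polynomial over every R; if R has a one, the integer part is redundant.
  record Multilinear (κ : Indeterminates) (m : ℕ) : Set c where
    field
      constant : Carrier
      terms    : List ((ℤ × Carrier) × Monomial κ m)

  monomialValue : {κ : Indeterminates} {m : ℕ} →
                  Vec Carrier m → Monomial κ m → Carrier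
  monomialValue a (i ∷ w , _) = foldl (λ z j → z * lookup a j) (lookup a i) w

  termValue : {κ : Indeterminates} {m : ℕ} →
              Vec Carrier m → (ℤ × Carrier) × Monomial κ m → Carrier
  termValue a ((n , b) , μ) = n · monomialValue a μ + b * monomialValue a μ

  ⟦_⟧ : {κ : Indeterminates} {m : ℕ} →
        Multilinear κ m → Vec Carrier m → Carrier
  ⟦ f ⟧ a = foldr (λ t z → termValue a t + z) constant terms
    where open Multilinear f

  IsIdentity : {κ : Indeterminates} {m : ℕ} → Multilinear κ m → Set (c l⊔ ℓ)
  IsIdentity {m = m} f = (a : Vec Carrier m) → ⟦ f ⟧ a ≈ 0#

Code : ℕ → Set
Code n = Vec Bool n

record Oracles (m n : ℕ) : Set where
  field
    add mul  : Code n → Code n → Code n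
    evaluate : Vec (Code n) m → Code n

-- Finiteness of the ring is the existence of the encoding by strings of
-- length n.  Oracle answers on strings that encode nothing are arbitrary.
record MIT (c ℓ : Level) (m k n : ℕ) : Set (lsuc (c l⊔ ℓ)) where
  field
    ring           : RingWithoutOne c ℓ
  open RingWithoutOne ring using (Carrier; _+_; _*_; 0#)
                           renaming (setoid to ringSetoid)
  open Polynomials ring
  field
    encoding       : Injection ringSetoid (setoid (Code n))
    generators     : Vec Carrier k
    generates      : GeneratesAdditively generators
    indeterminates : Indeterminates
    polynomial     : Multilinear indeterminates m
    oracles        : Oracles m n
  open Injection encoding using () renaming (to to encode)
  open Oracles oracles
  field
    add-correct      : (x y : Carrier) →
                       add (encode x) (encode y) ≡ encode (x + y)
    mul-correct      : (x y : Carrier) →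
                       mul (encode x) (encode y) ≡ encode (x * y)
    evaluate-correct : (a : Vec Carrier m) →
                       evaluate (map encode a) ≡ encode (⟦ polynomial ⟧ a)

  zeroCode : Code n
  zeroCode = encode 0#

  generatorCodes : Vec (Code n) k
  generatorCodes = map encode generators

  Yes : Set (c l⊔ ℓ)
  Yes = IsIdentity polynomial

-- Randomized decision trees: every path is finite, and what to do next may
-- depend arbitrarily on the answers and coin tosses so far.
data Computation (m n : ℕ) : Set where
  answer    : Bool → Computation m n
  toss      : (Bool → Computation m n) → Computation m n
  queryAdd  : Code n → Code n → (Code n → Computation m n) → Computation m n
  queryMul  : Code n → Code n → (Code n → Computation m n) → Computation m n
  queryEval : Vec (Code n) m → (Code n → Computation m n) → Computation m n

module _ {m n : ℕ} (O : Oracles m n) where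
  open Oracles O

  -- The maximum over all outcomes of the coin tosses.
  queries : Computation m n → ℕ
  queries (answer _)        = 0
  queries (toss p)          = queries (p false) ⊔ queries (p true)
  queries (queryAdd x y p)  = suc (queries (p (add x y)))
  queries (queryMul x y p)  = suc (queries (p (mul x y)))
  queries (queryEval a p)   = suc (queries (p (evaluate a)))

  -- The probability of the given answer, the coins being fair and independent.
  probability : Bool → Computation m n → ℚ
  probability b (answer b′) with b′ Bool.≟ b
  ... | yes _ = 1ℚ
  ... | no  _ = 0ℚ
  probability b (toss p)          =
    ½ ℚ.* (probability b (p false) ℚ.+ probability b (p true))
  probability b (queryAdd x y p)  = probability b (p (add x y))
  probability b (queryMul x y p)  = probability b (p (mul x y))
  probability b (queryEval a p)   = probability b (p (evaluate a))

-- The explicit input of an algorithm: the numbers m, k and n, the code of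
-- zero and the codes of the generators.  All else is accessed by queries.
Algorithm : Set
Algorithm = (m k n : ℕ) → Code n → Vec (Code n) k → Computation m n

run : {c ℓ : Level} {m k n : ℕ} → Algorithm → MIT c ℓ m k n → Computation m n
run {m = m} {k} {n} A I = A m k n (MIT.zeroCode I) (MIT.generatorCodes I)

{-# OPTIONS --safe #-}
module Submission where

-- In each indeterminate separately f is affine, and a nonzero affine function
-- on R is nonzero at a uniformly random subset sum of the generators with
-- probability at least 1/2: either it is constant, or some generator r moves
-- its value, and then it is nonzero at x or at x + r for every x.  Choosing the
-- indeterminates one after the other, f ≢ 0 is nonzero at a random point with
-- probability at least 2⁻ᵐ.  A trial costs m (k - 1) additions and one
-- evaluation, hence at most m k queries, and 4ᵐ trials all miss with probability
-- at most (1 - 2⁻ᵐ)^(4ᵐ) ≤ 1/(1 + 2ᵐ) ≤ 1/3.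

open import Defs
open import Algebra.Bundles using (AbelianGroup; RingWithoutOne)
import Algebra.Properties.CommutativeMonoid.Mult as Multiples
import Algebra.Properties.CommutativeSemigroup as CommutativeSemigroupProperties
import Algebra.Properties.AbelianGroup as AbelianGroupProperties
open import Data.Bool using (Bool; true; false; not; if_then_else_)
import Data.Bool.Properties as Bool
open import Data.Fin using (Fin; zero; suc)
import Data.Fin.Properties as Fin
open import Data.Integer using (+_; -[1+_])
open import Data.List using (List; []; _∷_; foldl)
open import Data.List.NonEmpty using (_∷_)
open import Data.List.Relation.Unary.All using (All; []; _∷_)
open import Data.List.Relation.Unary.AllPairs using (AllPairs; []; _∷_)
import Data.List.Relation.Unary.AllPairs as AllPairs
open import Data.Nat using (ℕ; zero; suc; NonZero; _+_; _*_; _^_; _≤_; pred; z≤n; s≤s; >-nonZero⁻¹)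
import Data.Nat.Properties as ℕ
open import Data.Product using (∃; _×_; _,_; proj₂)
open import Data.Rational using (ℚ; 0ℚ; 1ℚ; ½)
import Data.Rational as ℚ
import Data.Rational.Properties as ℚ
open import Data.Rational.Solver using (module +-*-Solver)
open import Data.Unit using (tt)
open import Data.Vec using (Vec; []; _∷_; lookup; map; _[_]≔_)
import Data.Vec.Properties as Vec
open import Function using (_∘_)
open import Function.Bundles using (Injection)
open import Level using (Level) renaming (_⊔_ to _l⊔_)
open import Relation.Binary.Definitions using (Decidable; DecidableEquality)
open import Relation.Binary.PropositionalEquality
  using (_≡_; _≢_; refl; sym; trans; cong; cong₂; module ≡-Reasoning)
open import Relation.Nullary using (¬_; yes; no; does; contradiction)
open import Relation.Nullary.Decidable using (via-injection; decidable-stable; toWitness)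

private
  variable
    c ℓ : Level
    k m n : ℕ

-- Averages of rationals and the arithmetic of repeated trials.

mean : ℚ → ℚ → ℚ
mean p q = ½ ℚ.* (p ℚ.+ q)

mean-mono-≤ : ∀ {p p′ q q′} → p ℚ.≤ p′ → q ℚ.≤ q′ → mean p q ℚ.≤ mean p′ q′
mean-mono-≤ p≤p′ q≤q′ = ℚ.*-monoˡ-≤-nonNeg ½ (ℚ.+-mono-≤ p≤p′ q≤q′)

mean-idem : ∀ p → mean p p ≡ p
mean-idem = solve 1 (λ p → con ½ :* (p :+ p) := p) refl
  where open +-*-Solver

mean≤ : ∀ {p q u} → p ℚ.≤ u → q ℚ.≤ u → mean p q ℚ.≤ u
mean≤ {u = u} p≤u q≤u = ℚ.≤-trans (mean-mono-≤ p≤u q≤u) (ℚ.≤-reflexive (mean-idem u))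

≤mean : ∀ {p q u} → u ℚ.≤ p → u ℚ.≤ q → u ℚ.≤ mean p q
≤mean {u = u} u≤p u≤q = ℚ.≤-trans (ℚ.≤-reflexive (sym (mean-idem u))) (mean-mono-≤ u≤p u≤q)

p≤p+q : ∀ {p q} → 0ℚ ℚ.≤ q → p ℚ.≤ p ℚ.+ q
p≤p+q {p} 0≤q = ℚ.≤-trans (ℚ.≤-reflexive (sym (ℚ.+-identityʳ p))) (ℚ.+-monoʳ-≤ p 0≤q)

-- This is 2⁻ᵐ u, by a recursion that unfolds in step with `missBound`.
halves : ℕ → ℚ → ℚ
halves zero    u = u
halves (suc m) u = ½ ℚ.* halves m u

-- Equal to (1 - 2⁻ᵐ) u.
missBound : ℕ → ℚ → ℚ
missBound zero    u = 0ℚ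
missBound (suc m) u = mean u (missBound m u)

missBound+halves : ∀ m u → missBound m u ℚ.+ halves m u ≡ u
missBound+halves zero    u = ℚ.+-identityˡ u
missBound+halves (suc m) u = begin
  ½ ℚ.* (u ℚ.+ missBound m u) ℚ.+ ½ ℚ.* halves m u
    ≡⟨ ℚ.*-distribˡ-+ ½ (u ℚ.+ missBound m u) (halves m u) ⟨
  ½ ℚ.* ((u ℚ.+ missBound m u) ℚ.+ halves m u)
    ≡⟨ cong (½ ℚ.*_) (ℚ.+-assoc u _ _) ⟩
  ½ ℚ.* (u ℚ.+ (missBound m u ℚ.+ halves m u))
    ≡⟨ cong (mean u) (missBound+halves m u) ⟩
  mean u u
    ≡⟨ mean-idem u ⟩
  u ∎
  where open ≡-Reasoning

halves-nonNeg : ∀ m {u} → 0ℚ ℚ.≤ u → 0ℚ ℚ.≤ halves m u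
halves-nonNeg zero    0≤u = 0≤u
halves-nonNeg (suc m) 0≤u =
  ℚ.≤-trans (ℚ.≤-reflexive (sym (ℚ.*-zeroʳ ½))) (ℚ.*-monoˡ-≤-nonNeg ½ (halves-nonNeg m 0≤u))

halves-mono-≤ : ∀ m {u v} → u ℚ.≤ v → halves m u ℚ.≤ halves m v
halves-mono-≤ zero    u≤v = u≤v
halves-mono-≤ (suc m) u≤v = ℚ.*-monoˡ-≤-nonNeg ½ (halves-mono-≤ m u≤v)

missBound≤ : ∀ m {u} → 0ℚ ℚ.≤ u → missBound m u ℚ.≤ u
missBound≤ m {u} 0≤u =
  ℚ.≤-trans (p≤p+q (halves-nonNeg m 0≤u)) (ℚ.≤-reflexive (missBound+halves m u))

open Multiples ℚ.+-0-commutativeMonoid using (×-assocˡ; ×-distrib-+) renaming (_×_ to _ℚ×_)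

ℚ×-nonNeg : ∀ t {u} → 0ℚ ℚ.≤ u → 0ℚ ℚ.≤ t ℚ× u
ℚ×-nonNeg zero    0≤u = ℚ.≤-refl
ℚ×-nonNeg (suc t) 0≤u = ℚ.+-mono-≤ 0≤u (ℚ×-nonNeg t 0≤u)

ℚ×-monoʳ-≤ : ∀ t {u v} → u ℚ.≤ v → t ℚ× u ℚ.≤ t ℚ× v
ℚ×-monoʳ-≤ zero    u≤v = ℚ.≤-refl
ℚ×-monoʳ-≤ (suc t) u≤v = ℚ.+-mono-≤ u≤v (ℚ×-monoʳ-≤ t u≤v)

4×½ : ∀ u → 4 ℚ× (½ ℚ.* u) ≡ u ℚ.+ u
4×½ = solve 1 (λ u → con ½ :* u :+ (con ½ :* u :+ (con ½ :* u :+ (con ½ :* u :+ con 0ℚ)))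
                       := u :+ u) refl
  where open +-*-Solver

-- The factor on the right is 4ᵐ 2⁻ᵐ = 2ᵐ, at least 2 because m ≥ 1. Equality holds at m = 1; each
-- further indeterminate quadruples the count and halves the summand, so the total doubles.
u+u≤4^m×halves : ∀ m .{{_ : NonZero m}} {u} → 0ℚ ℚ.≤ u →
                 u ℚ.+ u ℚ.≤ (4 ^ m) ℚ× halves m u
u+u≤4^m×halves (suc zero)      {u} 0≤u = ℚ.≤-reflexive (sym (4×½ u))
u+u≤4^m×halves (suc m@(suc _)) {u} 0≤u = begin
  u ℚ.+ u
    ≤⟨ u+u≤4^m×halves m 0≤u ⟩
  (4 ^ m) ℚ× h
    ≤⟨ p≤p+q (ℚ×-nonNeg (4 ^ m) (halves-nonNeg m 0≤u)) ⟩
  (4 ^ m) ℚ× h ℚ.+ (4 ^ m) ℚ× h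
    ≡⟨ ×-distrib-+ h h (4 ^ m) ⟨
  (4 ^ m) ℚ× (h ℚ.+ h)
    ≡⟨ cong ((4 ^ m) ℚ×_) (4×½ h) ⟨
  (4 ^ m) ℚ× (4 ℚ× (½ ℚ.* h))
    ≡⟨ ×-assocˡ (½ ℚ.* h) (4 ^ m) 4 ⟩
  (4 ^ m * 4) ℚ× (½ ℚ.* h)
    ≡⟨ cong (_ℚ× (½ ℚ.* h)) (ℕ.*-comm (4 ^ m) 4) ⟩
  (4 ^ suc m) ℚ× (½ ℚ.* h) ∎
  where
  open ℚ.≤-Reasoning
  h = halves m u

⅓ ⅔ : ℚ
⅓ = + 1 ℚ./ 3
⅔ = + 2 ℚ./ 3

u+[u+u]≤1⇒u≤⅓ : ∀ {u} → u ℚ.+ (u ℚ.+ u) ℚ.≤ 1ℚ → u ℚ.≤ ⅓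
u+[u+u]≤1⇒u≤⅓ {u} 3u≤1 = begin
  u                            ≡⟨ third u ⟩
  ⅓ ℚ.* (u ℚ.+ (u ℚ.+ u))      ≤⟨ ℚ.*-monoˡ-≤-nonNeg ⅓ 3u≤1 ⟩
  ⅓                            ∎
  where
  open ℚ.≤-Reasoning
  open +-*-Solver
  third : ∀ u → u ≡ ⅓ ℚ.* (u ℚ.+ (u ℚ.+ u))
  third = solve 1 (λ u → u := con ⅓ :* (u :+ (u :+ u))) refl

-- Multilinear polynomials are affine in each indeterminate.

module Affinity {c ℓ : Level} (R : RingWithoutOne c ℓ) where
  open RingWithoutOne R hiding (zero)
    renaming (_+_ to _⊕_; _*_ to _⊛_; refl to ≈-refl; sym to ≈-sym; trans to ≈-trans)
  open Polynomials R
  open AbelianGroupProperties +-abelianGroup using (⁻¹-∙-comm; ∙-cancelˡ; ∙-cancelʳ)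
  open CommutativeSemigroupProperties
    (AbelianGroup.commutativeSemigroup +-abelianGroup) using (interchange)
  open import Relation.Binary.Reasoning.Setoid setoid

  Constant : (Carrier → Carrier) → Set (c l⊔ ℓ)
  Constant g = ∀ x y → g x ≈ g y

  -- Says that x ↦ g x - g 0 is additive.
  record Affine (g : Carrier → Carrier) : Set (c l⊔ ℓ) where
    field
      resp   : ∀ {x y} → x ≈ y → g x ≈ g y
      affine : ∀ x y → g (x ⊕ y) ⊕ g 0# ≈ g x ⊕ g y
  open Affine

  constant-affine : ∀ {g} → Constant g → Affine g
  constant-affine g-const .resp   _   = g-const _ _
  constant-affine g-const .affine x y = +-cong (g-const _ _) (g-const _ _)

  +-affine : ∀ {g h} → Affine g → Affine h → Affine (λ x → g x ⊕ h x)
  +-affine g-aff h-aff .resp   x≈y = +-cong (resp g-aff x≈y) (resp h-aff x≈y)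
  +-affine g-aff h-aff .affine x y = ≈-trans (interchange _ _ _ _)
    (≈-trans (+-cong (affine g-aff x y) (affine h-aff x y)) (interchange _ _ _ _))

  -‿affine : ∀ {g} → Affine g → Affine (λ x → - g x)
  -‿affine g-aff .resp   x≈y = -‿cong (resp g-aff x≈y)
  -‿affine g-aff .affine x y = ≈-trans (⁻¹-∙-comm _ _)
    (≈-trans (-‿cong (affine g-aff x y)) (≈-sym (⁻¹-∙-comm _ _)))

  *-constant : ∀ {g h} → Constant g → Constant h → Constant (λ x → g x ⊛ h x)
  *-constant g-const h-const x y = *-cong (g-const x y) (h-const x y)

  -- Multiplication need not commute, so a constant factor is treated on each side separately.
  affine*constant : ∀ {g h} → Affine g → Constant h → Affine (λ x → g x ⊛ h x)
  affine*constant g-aff h-const .resp   x≈y = *-cong (resp g-aff x≈y) (h-const _ _)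
  affine*constant {g} {h} g-aff h-const .affine x y = begin
    g (x ⊕ y) ⊛ h (x ⊕ y) ⊕ g 0# ⊛ h 0#  ≈⟨ +-congʳ (*-congˡ (h-const _ _)) ⟩
    g (x ⊕ y) ⊛ h 0# ⊕ g 0# ⊛ h 0#       ≈⟨ distribʳ _ _ _ ⟨
    (g (x ⊕ y) ⊕ g 0#) ⊛ h 0#            ≈⟨ *-congʳ (affine g-aff x y) ⟩
    (g x ⊕ g y) ⊛ h 0#                   ≈⟨ distribʳ _ _ _ ⟩
    g x ⊛ h 0# ⊕ g y ⊛ h 0#              ≈⟨ +-cong (*-congˡ (h-const _ _)) (*-congˡ (h-const _ _)) ⟩
    g x ⊛ h x ⊕ g y ⊛ h y                ∎

  constant*affine : ∀ {g h} → Constant g → Affine h → Affine (λ x → g x ⊛ h x)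
  constant*affine g-const h-aff .resp   x≈y = *-cong (g-const _ _) (resp h-aff x≈y)
  constant*affine {g} {h} g-const h-aff .affine x y = begin
    g (x ⊕ y) ⊛ h (x ⊕ y) ⊕ g 0# ⊛ h 0#  ≈⟨ +-congʳ (*-congʳ (g-const _ _)) ⟩
    g 0# ⊛ h (x ⊕ y) ⊕ g 0# ⊛ h 0#       ≈⟨ distribˡ _ _ _ ⟨
    g 0# ⊛ (h (x ⊕ y) ⊕ h 0#)            ≈⟨ *-congˡ (affine h-aff x y) ⟩
    g 0# ⊛ (h x ⊕ h y)                   ≈⟨ distribˡ _ _ _ ⟩
    g 0# ⊛ h x ⊕ g 0# ⊛ h y              ≈⟨ +-cong (*-congʳ (g-const _ _)) (*-congʳ (g-const _ _)) ⟩
    g x ⊛ h x ⊕ g y ⊛ h y                ∎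

  ℕ·-affine : ∀ t {g} → Affine g → Affine (λ x → t ℕ· g x)
  ℕ·-affine zero    g-aff = constant-affine λ _ _ → ≈-refl
  ℕ·-affine (suc t) g-aff = +-affine g-aff (ℕ·-affine t g-aff)

  ·-affine : ∀ α {g} → Affine g → Affine (λ x → α · g x)
  ·-affine (+ t)    g-aff = ℕ·-affine t g-aff
  ·-affine -[1+ t ] g-aff = -‿affine (ℕ·-affine (suc t) g-aff)

  lookup-constant : ∀ (a : Vec Carrier m) {i j} → i ≢ j → Constant (λ x → lookup (a [ i ]≔ x) j)
  lookup-constant a i≢j x y = reflexive
    (trans (Vec.lookup∘update′ (i≢j ∘ sym) a x) (sym (Vec.lookup∘update′ (i≢j ∘ sym) a y)))

  lookup-affine : ∀ (a : Vec Carrier m) i → Affine (λ x → lookup (a [ i ]≔ x) i)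
  lookup-affine a i .resp {x} {y} x≈y =
    ≈-trans (reflexive (Vec.lookup∘update i a x))
      (≈-trans x≈y (reflexive (sym (Vec.lookup∘update i a y))))
  lookup-affine a i .affine x y
    rewrite Vec.lookup∘update i a (x ⊕ y) | Vec.lookup∘update i a 0#
          | Vec.lookup∘update i a x | Vec.lookup∘update i a y = +-identityʳ _

  -- Once the letter `i` has entered the accumulator, each later letter differs from it and is a
  -- right factor constant in `x`.
  foldl-affine : ∀ (a : Vec Carrier m) {i w g} → All (i ≢_) w → Affine g →
                 Affine (λ x → foldl (λ z j → z ⊛ lookup (a [ i ]≔ x) j) (g x) w)
  foldl-affine a []          g-aff = g-aff
  foldl-affine a (i≢j ∷ i∉w) g-aff =
    foldl-affine a i∉w (affine*constant g-aff (lookup-constant a i≢j))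

  -- Until `i` is met, the partial product does not depend on `x`. Distinctness ensures that `i` is
  -- met at most once, and from there `foldl-affine` takes over.
  foldl-constant-affine :
    ∀ (a : Vec Carrier m) i {w g} → AllPairs _≢_ w → Constant g →
    Affine (λ x → foldl (λ z j → z ⊛ lookup (a [ i ]≔ x) j) (g x) w)
  foldl-constant-affine a i []                g-const = constant-affine g-const
  foldl-constant-affine a i {j ∷ w} (j∉w ∷ w-distinct) g-const with i Fin.≟ j
  ... | yes refl = foldl-affine a j∉w (constant*affine g-const (lookup-affine a i))
  ... | no  i≢j  =
    foldl-constant-affine a i w-distinct (*-constant g-const (lookup-constant a i≢j))

  -- That no letter repeats is what affinity rests on, so both kinds of indeterminates can be
  -- treated together from here.
  distinct : ∀ κ {w : List (Fin m)} → AllPairs (Precedes κ m) w → AllPairs _≢_ w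
  distinct commuting    = AllPairs.map Fin.<⇒≢
  distinct noncommuting w-distinct = w-distinct

  monomialValue-affine : ∀ κ (a : Vec Carrier m) i (μ : Monomial κ m) →
                         Affine (λ x → monomialValue {κ} (a [ i ]≔ x) μ)
  monomialValue-affine κ a i (j ∷ w , w-ordered) with distinct κ w-ordered
  -- Without a one in the ring, the product starts at the first letter itself, which therefore needs
  -- its own case distinction.
  ... | j∉w ∷ w-distinct with i Fin.≟ j
  ...   | yes refl = foldl-affine a j∉w (lookup-affine a i)
  ...   | no  i≢j  = foldl-constant-affine a i w-distinct (lookup-constant a i≢j)

  MultiAffine : (Vec Carrier m → Carrier) → Set (c l⊔ ℓ)
  MultiAffine F = ∀ i a → Affine (λ x → F (a [ i ]≔ x))

  ⟦⟧-multiAffine : ∀ {κ} (f : Multilinear κ m) → MultiAffine ⟦ f ⟧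
  ⟦⟧-multiAffine {κ = κ} f i a = go (Multilinear.terms f)
    where
    open Multilinear f using (constant)
    go : ∀ ts → Affine (λ x → ⟦ record { constant = constant ; terms = ts } ⟧ (a [ i ]≔ x))
    go []                   = constant-affine λ _ _ → ≈-refl
    go (((α , b) , μ) ∷ ts) = +-affine
      (+-affine (·-affine α μ-aff) (constant*affine (λ _ _ → ≈-refl) μ-aff)) (go ts)
      where μ-aff = monomialValue-affine κ a i μ

  -- The subgroup of elements that do not move an affine map.

  module _ {g} (g-aff : Affine g) where
    private
      -- The kernel of the additive map x ↦ g x - g 0.
      Level₀ : Carrier → Set ℓ
      Level₀ x = g x ≈ g 0#

    level₀-+ : ∀ {x y} → Level₀ x → Level₀ y → Level₀ (x ⊕ y)
    level₀-+ {x} {y} x₀ y₀ = ∙-cancelʳ _ _ _ (≈-trans (affine g-aff x y) (+-cong x₀ y₀))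

    level₀-neg : ∀ {x} → Level₀ x → Level₀ (- x)
    level₀-neg {x} x₀ = ∙-cancelˡ (g 0#) _ _ (begin
      g 0# ⊕ g (- x)       ≈⟨ +-congʳ x₀ ⟨
      g x ⊕ g (- x)        ≈⟨ affine g-aff x (- x) ⟨
      g (x ⊕ - x) ⊕ g 0#   ≈⟨ +-congʳ (resp g-aff (-‿inverseʳ x)) ⟩
      g 0# ⊕ g 0#          ∎)

    level₀-ℕ· : ∀ t {x} → Level₀ x → Level₀ (t ℕ· x)
    level₀-ℕ· zero    x₀ = ≈-refl
    level₀-ℕ· (suc t) x₀ = level₀-+ x₀ (level₀-ℕ· t x₀)

    level₀-· : ∀ α {x} → Level₀ x → Level₀ (α · x)
    level₀-· (+ t)    x₀ = level₀-ℕ· t x₀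
    level₀-· -[1+ t ] x₀ = level₀-neg (level₀-ℕ· (suc t) x₀)

    level₀-sum : ∀ {k} {s : Fin k → Carrier} → (∀ j → Level₀ (s j)) → Level₀ (sum s)
    level₀-sum {zero}  s₀ = ≈-refl
    level₀-sum {suc k} s₀ = level₀-+ (s₀ zero) (level₀-sum (s₀ ∘ suc))

    -- The kernel `Level₀` is a subgroup; if it contains all generators, it is the whole ring.
    constant-on-generators⇒constant :
      (r : Vec Carrier k) → GeneratesAdditively r → (∀ j → g (lookup r j) ≈ g 0#) → Constant g
    constant-on-generators⇒constant r generates r₀ x y = ≈-trans (level₀ x) (≈-sym (level₀ y))
      where
      level₀ : ∀ x → Level₀ x
      level₀ x with generates x
      ... | α , x≈Σ = ≈-trans (resp g-aff x≈Σ) (level₀-sum λ j → level₀-· (α j) (r₀ j))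

    zero-pair⇒level₀ : ∀ {x r} → g x ≈ 0# → g (x ⊕ r) ≈ 0# → Level₀ r
    zero-pair⇒level₀ {x} {r} gx≈0 gx+r≈0 = begin
      g r                 ≈⟨ +-identityˡ _ ⟨
      0# ⊕ g r            ≈⟨ +-congʳ gx≈0 ⟨
      g x ⊕ g r           ≈⟨ affine g-aff x r ⟨
      g (x ⊕ r) ⊕ g 0#    ≈⟨ +-congʳ gx+r≈0 ⟩
      0# ⊕ g 0#           ≈⟨ +-identityˡ _ ⟩
      g 0#                ∎

  -- Expectations over random subset sums.

  -- The expectation of φ at acc plus a uniformly random subset sum of rs.
  expectSum : Vec Carrier k → Carrier → (Carrier → ℚ) → ℚ
  expectSum []       acc φ = φ acc
  expectSum (r ∷ rs) acc φ = mean (expectSum rs acc φ) (expectSum rs (acc ⊕ r) φ)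

  expectVec : Vec Carrier k → (m : ℕ) → (Vec Carrier m → ℚ) → ℚ
  expectVec rs zero    φ = φ []
  expectVec rs (suc m) φ = expectSum rs 0# (λ x → expectVec rs m (φ ∘ (x ∷_)))

  expectSum-cong : ∀ (rs : Vec Carrier k) acc {φ ψ} → (∀ x → φ x ≡ ψ x) →
                   expectSum rs acc φ ≡ expectSum rs acc ψ
  expectSum-cong []       acc φ≗ψ = φ≗ψ acc
  expectSum-cong (r ∷ rs) acc φ≗ψ =
    cong₂ mean (expectSum-cong rs acc φ≗ψ) (expectSum-cong rs (acc ⊕ r) φ≗ψ)

  expectSum-≤ : ∀ (rs : Vec Carrier k) acc {φ u} → (∀ x → φ x ℚ.≤ u) → expectSum rs acc φ ℚ.≤ u
  expectSum-≤ []       acc φ≤u = φ≤u acc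
  expectSum-≤ (r ∷ rs) acc φ≤u = mean≤ (expectSum-≤ rs acc φ≤u) (expectSum-≤ rs (acc ⊕ r) φ≤u)

  expectVec-≤ : ∀ (rs : Vec Carrier k) m {φ u} → (∀ a → φ a ℚ.≤ u) → expectVec rs m φ ℚ.≤ u
  expectVec-≤ rs zero    φ≤u = φ≤u []
  expectVec-≤ rs (suc m) φ≤u =
    expectSum-≤ rs 0# λ x → expectVec-≤ rs m (φ≤u ∘ (x ∷_))

  -- The probability of missing a nonzero value.

  module _ (_≈?_ : Decidable _≈_) where

    module _ {g : Carrier → Carrier} (g-aff : Affine g) {φ : Carrier → ℚ} {u v : ℚ}
             (φ≤u : ∀ x → φ x ℚ.≤ u) (φ≤v : ∀ x → ¬ g x ≈ 0# → φ x ℚ.≤ v) where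

      -- If r moves the value of g, then g does not vanish at both of x and x + r.
      mean-pair-≤ : ∀ {r} → ¬ g r ≈ g 0# → ∀ {s} (rs : Vec Carrier s) {x y} → y ≈ x ⊕ r →
                    mean (expectSum rs x φ) (expectSum rs y φ) ℚ.≤ mean u v
      mean-pair-≤ {r} r-moves [] {x} {y} y≈x+r with g x ≈? 0#
      ... | no  gx≉0 = ℚ.≤-trans (mean-mono-≤ (φ≤v x gx≉0) (φ≤u y))
                         (ℚ.≤-reflexive (cong (½ ℚ.*_) (ℚ.+-comm v u)))
      ... | yes gx≈0 = mean-mono-≤ (φ≤u x) (φ≤v y λ gy≈0 → r-moves
                         (zero-pair⇒level₀ g-aff gx≈0 (≈-trans (resp g-aff (≈-sym y≈x+r)) gy≈0)))
      -- The four averages are regrouped so that each inner pair makes the same choice about `r′`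
      -- and still differs by `r`. This shift survives only up to `≈`, which is why `y` is not
      -- simply `x ⊕ r`.
      mean-pair-≤ {r} r-moves (r′ ∷ rs) {x} {y} y≈x+r = ℚ.≤-trans
        (ℚ.≤-reflexive (mean-interchange (expectSum rs x φ) (expectSum rs (x ⊕ r′) φ)
                                         (expectSum rs y φ) (expectSum rs (y ⊕ r′) φ)))
        (mean≤ (mean-pair-≤ r-moves rs y≈x+r) (mean-pair-≤ r-moves rs shifted))
        where
        mean-interchange : ∀ p q p′ q′ →
          mean (mean p q) (mean p′ q′) ≡ mean (mean p p′) (mean q q′)
        mean-interchange = solve 4 (λ p q p′ q′ →
          con ½ :* (con ½ :* (p :+ q) :+ con ½ :* (p′ :+ q′)) :=
          con ½ :* (con ½ :* (p :+ p′) :+ con ½ :* (q :+ q′))) refl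
          where open +-*-Solver
        shifted : y ⊕ r′ ≈ (x ⊕ r′) ⊕ r
        shifted = begin
          y ⊕ r′          ≈⟨ +-congʳ y≈x+r ⟩
          (x ⊕ r) ⊕ r′    ≈⟨ +-assoc x r r′ ⟩
          x ⊕ (r ⊕ r′)    ≈⟨ +-congˡ (+-comm r r′) ⟩
          x ⊕ (r′ ⊕ r)    ≈⟨ +-assoc x r′ r ⟨
          (x ⊕ r′) ⊕ r    ∎

      -- Whatever was chosen for the generators before the moving one, its own toss pairs the
      -- remaining outcomes.
      expectSum-moving : (rs : Vec Carrier k) → ∀ j → ¬ g (lookup rs j) ≈ g 0# →
                         ∀ acc → expectSum rs acc φ ℚ.≤ mean u v
      expectSum-moving (r ∷ rs) zero    r-moves acc = mean-pair-≤ r-moves rs ≈-refl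
      expectSum-moving (r ∷ rs) (suc j) r-moves acc =
        mean≤ (expectSum-moving rs j r-moves acc) (expectSum-moving rs j r-moves (acc ⊕ r))

      -- If no generator moves `g`, then `g` is a nonzero constant and `v` bounds `φ` everywhere;
      -- otherwise a moving generator gives the bound. Here `u` is the trivial bound, and `v` the
      -- better one where `g` is nonzero.
      expectSum-miss : (rs : Vec Carrier k) → GeneratesAdditively rs → v ℚ.≤ u →
                       ∀ {x} → ¬ g x ≈ 0# → ∀ acc → expectSum rs acc φ ℚ.≤ mean u v
      expectSum-miss rs generates v≤u {x} gx≉0 acc
        with Fin.all? (λ j → g (lookup rs j) ≈? g 0#)
      ... | yes r₀ = ℚ.≤-trans
        (expectSum-≤ rs acc λ y → φ≤v y λ gy≈0 → gx≉0
          (≈-trans (constant-on-generators⇒constant g-aff rs generates r₀ x y) gy≈0))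
        (≤mean v≤u ℚ.≤-refl)
      ... | no ¬r₀ with Fin.¬∀⟶∃¬ _ _ (λ j → g (lookup rs j) ≈? g 0#) ¬r₀
      ...   | j , r-moves = expectSum-moving rs j r-moves acc

    -- Induction on the coordinates along a nonzero point `x ∷ a`: the affine map `F (_ ∷ a)` is
    -- nonzero at `x`, and wherever it is nonzero at some `y`, the same tail `a` witnesses that
    -- `F (y ∷_)` is nonzero. So `v` is the bound for one coordinate fewer.
    expectVec-miss : (rs : Vec Carrier k) → GeneratesAdditively rs →
                     ∀ m {F : Vec Carrier m → Carrier} → MultiAffine F →
                     ∀ a → ¬ F a ≈ 0# → ∀ {φ u} → 0ℚ ℚ.≤ u → (∀ b → φ b ℚ.≤ u) →
                     (∀ b → ¬ F b ≈ 0# → φ b ℚ.≤ 0ℚ) → expectVec rs m φ ℚ.≤ missBound m u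
    expectVec-miss rs generates zero    F-aff []      Fa≉0 0≤u φ≤u φ≤0 = φ≤0 [] Fa≉0
    expectVec-miss rs generates (suc m) {F} F-aff (x ∷ a) Fa≉0 0≤u φ≤u φ≤0 =
      expectSum-miss {g = λ y → F (y ∷ a)} (F-aff zero (x ∷ a))
        (λ y → expectVec-≤ rs m (φ≤u ∘ (y ∷_)))
        (λ y Fya≉0 → expectVec-miss rs generates m (λ i b → F-aff (suc i) (y ∷ b))
                       a Fya≉0 0≤u (φ≤u ∘ (y ∷_)) (φ≤0 ∘ (y ∷_)))
        rs generates (missBound≤ m 0≤u) {x = x} Fa≉0 0#

-- The algorithm.

_≟ᶜ_ : DecidableEquality (Code n)
_≟ᶜ_ = Vec.≡-dec Bool._≟_

-- The free addition to the code z of zero is what saves one query per indeterminate.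
plus : Code n → Code n → Code n → (Code n → Computation m n) → Computation m n
plus z x y p = if does (x ≟ᶜ z) then p y else queryAdd x y p

-- Continuation-passing style grafts the rest of the computation onto every leaf of the sampling
-- tree.
sampleSum : Code n → Vec (Code n) k → Code n → (Code n → Computation m n) → Computation m n
sampleSum z []       acc p = p acc
sampleSum z (r ∷ rs) acc p =
  toss λ b → if b then plus z acc r (λ s → sampleSum z rs s p) else sampleSum z rs acc p

sampleVec : Code n → Vec (Code n) k → (l : ℕ) →
            (Vec (Code n) l → Computation m n) → Computation m n
sampleVec z rs zero    p = p []
sampleVec z rs (suc l) p = sampleSum z rs z λ x → sampleVec z rs l (p ∘ (x ∷_))

trials : Code n → Vec (Code n) k → ℕ → Computation m n
trials         z rs zero    = answer true
trials {m = m} z rs (suc t) = sampleVec z rs m λ a → queryEval a λ v →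
  if does (v ≟ᶜ z) then trials z rs t else answer false

identityTest : Algorithm
-- For `k = 0` the query bound is 0, so not even one evaluation is allowed.
identityTest m zero    n z rs = answer true
identityTest m (suc _) n z rs = trials z rs (4 ^ m)

-- Counting queries.

module _ (O : Oracles m n) where

  queries-plus : ∀ z x y p {b} → (∀ s → queries O (p s) ≤ b) → queries O (plus z x y p) ≤ suc b
  queries-plus z x y p p≤b with does (x ≟ᶜ z)
  ... | true  = ℕ.m≤n⇒m≤1+n (p≤b y)
  ... | false = s≤s (p≤b _)

  queries-plus-zero : ∀ z y p → queries O (plus z z y p) ≡ queries O (p y)
  queries-plus-zero z y p with z ≟ᶜ z
  ... | yes _   = refl
  ... | no  z≢z = contradiction refl z≢z

  queries-sampleSum : ∀ z (rs : Vec (Code n) k) acc p {b} → (∀ s → queries O (p s) ≤ b) →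
                      queries O (sampleSum z rs acc p) ≤ k + b
  queries-sampleSum z []       acc p p≤b = p≤b acc
  queries-sampleSum z (r ∷ rs) acc p p≤b = ℕ.⊔-lub
    (ℕ.m≤n⇒m≤1+n (queries-sampleSum z rs acc p p≤b))
    (queries-plus z acc r _ λ s → queries-sampleSum z rs s p p≤b)

  -- The first toss costs nothing, since the accumulator is still zero; each of the `pred k`
  -- generators after it costs at most one addition.
  queries-sampleSum-zero : ∀ z (rs : Vec (Code n) k) p {b} → (∀ s → queries O (p s) ≤ b) →
                           queries O (sampleSum z rs z p) ≤ pred k + b
  queries-sampleSum-zero z []       p p≤b = p≤b z
  queries-sampleSum-zero z (r ∷ rs) p p≤b = ℕ.⊔-lub
    (queries-sampleSum z rs z p p≤b)
    (ℕ.≤-trans (ℕ.≤-reflexive (queries-plus-zero z r _)) (queries-sampleSum z rs r p p≤b))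

  queries-sampleVec : ∀ z (rs : Vec (Code n) k) l p {b} → (∀ a → queries O (p a) ≤ b) →
                      queries O (sampleVec z rs l p) ≤ l * pred k + b
  queries-sampleVec         z rs zero    p p≤b = p≤b []
  queries-sampleVec {k = k} z rs (suc l) p {b} p≤b = ℕ.≤-trans
    (queries-sampleSum-zero z rs _ λ x → queries-sampleVec z rs l (p ∘ (x ∷_)) (p≤b ∘ (x ∷_)))
    (ℕ.≤-reflexive (sym (ℕ.+-assoc (pred k) (l * pred k) b)))

  queries-trials : .{{_ : NonZero m}} → ∀ z (rs : Vec (Code n) (suc k)) t →
                   queries O (trials z rs t) ≤ t * (m * suc k)
  queries-trials         z rs zero    = z≤n
  queries-trials {k = k} z rs (suc t) = begin
    queries O (trials z rs (suc t))   ≤⟨ queries-sampleVec z rs m _ after-eval ⟩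
    m * k + suc (t * (m * suc k))     ≡⟨ ℕ.+-suc (m * k) _ ⟩
    -- The evaluation is paid for by one of the `m` saved additions, which exists because m ≥ 1.
    suc (m * k) + t * (m * suc k)     ≤⟨ ℕ.+-monoˡ-≤ _ (ℕ.+-monoˡ-≤ (m * k) (>-nonZero⁻¹ m)) ⟩
    (m + m * k) + t * (m * suc k)     ≡⟨ cong (_+ t * (m * suc k)) (ℕ.*-suc m k) ⟨
    suc t * (m * suc k)               ∎
    where
    open ℕ.≤-Reasoning
    after-eval : ∀ a → queries O (queryEval a λ v →
      if does (v ≟ᶜ z) then trials z rs t else answer false) ≤ suc (t * (m * suc k))
    after-eval a with does (Oracles.evaluate O a ≟ᶜ z)
    ... | true  = s≤s (queries-trials z rs t)
    ... | false = s≤s z≤n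

  queries-identityTest : .{{_ : NonZero m}} → ∀ z (rs : Vec (Code n) k) →
                         queries O (identityTest m k n z rs) ≤ 4 ^ m * m * k
  queries-identityTest {k = zero}      z rs = z≤n
  queries-identityTest {k = k@(suc _)} z rs =
    ℕ.≤-trans (queries-trials z rs (4 ^ m)) (ℕ.≤-reflexive (sym (ℕ.*-assoc (4 ^ m) m k)))

  -- Probabilities of complementary answers.

  probability-nonNeg : ∀ b (p : Computation m n) → 0ℚ ℚ.≤ probability O b p
  probability-nonNeg b (answer b′) with b′ Bool.≟ b
  ... | yes _ = toWitness {a? = 0ℚ ℚ.≤? 1ℚ} tt
  ... | no  _ = ℚ.≤-refl
  probability-nonNeg b (toss p) =
    ≤mean (probability-nonNeg b (p false)) (probability-nonNeg b (p true))
  probability-nonNeg b (queryAdd x y p) = probability-nonNeg b (p _)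
  probability-nonNeg b (queryMul x y p) = probability-nonNeg b (p _)
  probability-nonNeg b (queryEval a p)  = probability-nonNeg b (p _)

  probability-complement : ∀ b (p : Computation m n) →
                           probability O b p ℚ.+ probability O (not b) p ≡ 1ℚ
  probability-complement false (answer false) = refl
  probability-complement false (answer true)  = refl
  probability-complement true  (answer false) = refl
  probability-complement true  (answer true)  = refl
  probability-complement b (toss p) = trans
    (regroup (probability O b (p false)) (probability O b (p true)) _ _)
    (cong₂ mean (probability-complement b (p false)) (probability-complement b (p true)))
    where
    open +-*-Solver
    regroup : ∀ x y x′ y′ → mean x y ℚ.+ mean x′ y′ ≡ mean (x ℚ.+ x′) (y ℚ.+ y′)
    regroup = solve 4 (λ x y x′ y′ → con ½ :* (x :+ y) :+ con ½ :* (x′ :+ y′) :=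
                                     con ½ :* ((x :+ x′) :+ (y :+ y′))) refl
  probability-complement b (queryAdd x y p) = probability-complement b (p _)
  probability-complement b (queryMul x y p) = probability-complement b (p _)
  probability-complement b (queryEval a p)  = probability-complement b (p _)

  -- Reduces both guarantees to bounding the probability of the wrong answer.
  probability-≤⅓⇒⅔≤ : ∀ b (p : Computation m n) →
                      probability O b p ℚ.≤ ⅓ → ⅔ ℚ.≤ probability O (not b) p
  probability-≤⅓⇒⅔≤ b p P≤⅓ = begin
    ⅔                                        ≡⟨ cong (ℚ._+ (ℚ.- ⅓)) (probability-complement b p) ⟨
    (P ℚ.+ P′) ℚ.+ (ℚ.- ⅓)                   ≤⟨ ℚ.+-monoˡ-≤ (ℚ.- ⅓) (ℚ.+-monoˡ-≤ P′ P≤⅓) ⟩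
    (⅓ ℚ.+ P′) ℚ.+ (ℚ.- ⅓)                   ≡⟨ cancel-⅓ P′ ⟩
    P′                                       ∎
    where
    open ℚ.≤-Reasoning
    open +-*-Solver
    cancel-⅓ : ∀ q → (⅓ ℚ.+ q) ℚ.+ (ℚ.- ⅓) ≡ q
    cancel-⅓ = solve 1 (λ q → (con ⅓ :+ q) :+ con (ℚ.- ⅓) := q) refl
    P  = probability O b p
    P′ = probability O (not b) p

-- From codes and coin tosses to random ring elements.

module Correctness {c ℓ : Level} {m k n : ℕ} (I : MIT c ℓ m k n) where
  open MIT I
  open RingWithoutOne ring using (Carrier; _≈_; 0#; +-congʳ; +-identityˡ)
    renaming (_+_ to _⊕_; sym to ≈-sym; trans to ≈-trans)
  open Polynomials ring using (⟦_⟧)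
  open Affinity ring
  open Injection encoding using (injective) renaming (to to encode; cong to encode-cong)
  open Oracles oracles

  _≈?_ : Decidable _≈_
  _≈?_ = via-injection encoding _≟ᶜ_

  P : Bool → Computation m n → ℚ
  P = probability oracles

  -- The shortcut is sound because the encoding is injective: an `x` whose code is that of zero is
  -- zero, so `y` and `x ⊕ y` share a code.
  probability-plus : ∀ b x y p →
    P b (plus zeroCode (encode x) (encode y) p) ≡ P b (p (encode (x ⊕ y)))
  probability-plus b x y p with encode x ≟ᶜ zeroCode
  ... | yes x≡0 = cong (P b ∘ p)
    (encode-cong (≈-sym (≈-trans (+-congʳ (injective x≡0)) (+-identityˡ y))))
  ... | no  _   = cong (P b ∘ p) (add-correct x y)

  -- Every code that arises encodes a ring element, so arbitrary oracle answers on other strings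
  -- never matter.
  probability-sampleSum : ∀ b {s} (rs : Vec Carrier s) acc p →
    P b (sampleSum zeroCode (map encode rs) (encode acc) p) ≡ expectSum rs acc (P b ∘ p ∘ encode)
  probability-sampleSum b []       acc p = refl
  probability-sampleSum b (r ∷ rs) acc p = cong₂ mean
    (probability-sampleSum b rs acc p)
    (trans (probability-plus b acc r _) (probability-sampleSum b rs (acc ⊕ r) p))

  probability-sampleVec : ∀ b l p →
    P b (sampleVec zeroCode generatorCodes l p) ≡ expectVec generators l (P b ∘ p ∘ map encode)
  probability-sampleVec b zero    p = refl
  probability-sampleVec b (suc l) p = trans
    (probability-sampleSum b generators 0# _)
    (expectSum-cong generators 0# λ x → probability-sampleVec b l (p ∘ (encode x ∷_)))

  -- One-sided error and its amplification.

  test : ℕ → Computation m n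
  test = trials zeroCode generatorCodes

  -- The probability of the evaluation step of a trial unfolds to that of this continuation.
  afterEval : ℕ → Vec (Code n) m → Computation m n
  afterEval t a = if does (evaluate a ≟ᶜ zeroCode) then test t else answer false

  evaluate≡0⇒≈0 : ∀ a → evaluate (map encode a) ≡ zeroCode → ⟦ polynomial ⟧ a ≈ 0#
  evaluate≡0⇒≈0 a v≡0 = injective (trans (sym (evaluate-correct a)) v≡0)

  yes-never-rejected : Yes → ∀ t → P false (test t) ℚ.≤ 0ℚ
  yes-never-rejected f≈0 zero    = ℚ.≤-refl
  yes-never-rejected f≈0 (suc t) = ℚ.≤-trans (ℚ.≤-reflexive (probability-sampleVec false m _))
    (expectVec-≤ generators m trial-≤)
    where
    trial-≤ : ∀ a → P false (afterEval t (map encode a)) ℚ.≤ 0ℚ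
    trial-≤ a with evaluate (map encode a) ≟ᶜ zeroCode
    ... | yes _   = yes-never-rejected f≈0 t
    ... | no  v≢0 = contradiction (trans (evaluate-correct a) (encode-cong (f≈0 a))) v≢0

  module _ (a : Vec Carrier m) (fa≉0 : ¬ ⟦ polynomial ⟧ a ≈ 0#) where

    survival : ℕ → ℚ
    survival t = P true (test t)

    survival-nonNeg : ∀ t → 0ℚ ℚ.≤ survival t
    survival-nonNeg t = probability-nonNeg oracles true (test t)

    -- After a sampled point, survival has probability at most `survival t`, and 0 where the
    -- polynomial is nonzero; this is `expectVec-miss` with `u` equal to `survival t`.
    survival-suc-≤ : ∀ t → survival (suc t) ℚ.≤ missBound m (survival t)
    survival-suc-≤ t = ℚ.≤-trans (ℚ.≤-reflexive (probability-sampleVec true m _))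
      (expectVec-miss _≈?_ generators generates m (⟦⟧-multiAffine polynomial) a fa≉0
        (survival-nonNeg t) trial-≤ trial-hit)
      where
      trial-≤ : ∀ b → P true (afterEval t (map encode b)) ℚ.≤ survival t
      trial-≤ b with evaluate (map encode b) ≟ᶜ zeroCode
      ... | yes _ = ℚ.≤-refl
      ... | no  _ = survival-nonNeg t
      trial-hit : ∀ b → ¬ ⟦ polynomial ⟧ b ≈ 0# → P true (afterEval t (map encode b)) ℚ.≤ 0ℚ
      trial-hit b fb≉0 with evaluate (map encode b) ≟ᶜ zeroCode
      ... | yes v≡0 = contradiction (evaluate≡0⇒≈0 b v≡0) fb≉0
      ... | no  _   = ℚ.≤-refl

    -- Each trial loses at least 2⁻ᵐ times the current survival probability,
    -- which is at least 2⁻ᵐ times the final one.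
    survival-bound : ∀ t → survival t ℚ.+ t ℚ× halves m (survival t) ℚ.≤ 1ℚ
    survival-bound zero    = ℚ.≤-refl
    survival-bound (suc t) = begin
      q′ ℚ.+ (halves m q′ ℚ.+ t ℚ× halves m q′)
        ≡⟨ ℚ.+-assoc q′ (halves m q′) _ ⟨
      (q′ ℚ.+ halves m q′) ℚ.+ t ℚ× halves m q′
        ≤⟨ ℚ.+-mono-≤ (ℚ.+-mono-≤ (survival-suc-≤ t) halves≤) (ℚ×-monoʳ-≤ t halves≤) ⟩
      (missBound m q ℚ.+ halves m q) ℚ.+ t ℚ× halves m q
        ≡⟨ cong (ℚ._+ t ℚ× halves m q) (missBound+halves m q) ⟩
      q ℚ.+ t ℚ× halves m q
        ≤⟨ survival-bound t ⟩
      1ℚ ∎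
      where
      open ℚ.≤-Reasoning
      q  = survival t
      q′ = survival (suc t)
      halves≤ : halves m q′ ℚ.≤ halves m q
      halves≤ = halves-mono-≤ m (ℚ.≤-trans (survival-suc-≤ t) (missBound≤ m (survival-nonNeg t)))

    -- With q the final survival probability, q + 4ᵐ 2⁻ᵐ q ≤ 1 and 4ᵐ 2⁻ᵐ ≥ 2 give 3q ≤ 1.
    survival-≤⅓ : .{{_ : NonZero m}} → survival (4 ^ m) ℚ.≤ ⅓
    survival-≤⅓ = u+[u+u]≤1⇒u≤⅓ (ℚ.≤-trans
      (ℚ.+-monoʳ-≤ (survival (4 ^ m)) (u+u≤4^m×halves m (survival-nonNeg (4 ^ m))))
      (survival-bound (4 ^ m)))

-- The two guarantees and the theorem.

module _ .{{_ : NonZero m}} where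

  accepts : (I : MIT c ℓ m k n) → MIT.Yes I →
            ⅔ ℚ.≤ probability (MIT.oracles I) true (run identityTest I)
  accepts {k = zero}  I f≈0 = toWitness {a? = ⅔ ℚ.≤? 1ℚ} tt
  accepts {k = suc _} I f≈0 = probability-≤⅓⇒⅔≤ (MIT.oracles I) false (test (4 ^ m))
    (ℚ.≤-trans (yes-never-rejected f≈0 (4 ^ m)) (toWitness {a? = 0ℚ ℚ.≤? ⅓} tt))
    where open Correctness I

  rejects : (I : MIT c ℓ m k n) → ¬ MIT.Yes I →
            ⅔ ℚ.≤ probability (MIT.oracles I) false (run identityTest I)
  -- A ring without generators is trivial, so every polynomial is an identity.
  rejects {k = zero}  I f≉0 =
    contradiction (λ a → proj₂ (MIT.generates I (⟦ MIT.polynomial I ⟧ a))) f≉0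
    where open Polynomials (MIT.ring I) using (⟦_⟧)
  -- The hypothesis `f≉0` yields no explicit nonzero point. As the goal is decidable, its failure
  -- may be assumed; any nonzero value would then contradict it, so the polynomial would be an
  -- identity.
  rejects {k = suc _} I f≉0 = decidable-stable (⅔ ℚ.≤? _) λ ⅔≰P → f≉0 λ a →
    decidable-stable (⟦ MIT.polynomial I ⟧ a ≈? 0#) λ fa≉0 →
      ⅔≰P (probability-≤⅓⇒⅔≤ (MIT.oracles I) true (test (4 ^ m)) (survival-≤⅓ a fa≉0))
    where
    open Correctness I
    open RingWithoutOne (MIT.ring I) using (0#)
    open Polynomials (MIT.ring I) using (⟦_⟧)

corollary3p7 : (c ℓ : Level) →
    ∃ λ (p : ℚ) → (½ ℚ.< p) × (∃ λ (A : Algorithm) →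
    (m k n : ℕ) → .{{_ : NonZero m}} → (I : MIT c ℓ m k n) →
    (queries (MIT.oracles I) (run A I) ≤ 4 ^ m * m * k)
    × (MIT.Yes I → p ℚ.≤ probability (MIT.oracles I) true (run A I))
    × (¬ MIT.Yes I → p ℚ.≤ probability (MIT.oracles I) false (run A I)))
corollary3p7 c ℓ = ⅔ , toWitness {a? = ½ ℚ.<? ⅔} tt , identityTest , λ m k n I →
  queries-identityTest (MIT.oracles I) (MIT.zeroCode I) (MIT.generatorCodes I) ,
  accepts I , rejects I
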